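{- Let $S$ be a set of symbols with $|S| = 8$. In the erase-repetition game over $S$, Ann has a strategy to build an arbitrarily long nonrepetitive sequence: for every positive integer $n$, Ann has a strategy guaranteeing that, no matter how Ben plays, at some point of the game the current sequence has length at least $n$.
   Context: A repetition of size $h$ ($h \geq 1$) in a sequence is a block of consecutive terms of the form $x_1 \dots x_h x_1 \dots x_h$. A sequence is nonrepetitive if it contains no repetition of any size. The erase-repetition game over a symbol set $S$ is played by two players, Ann (moving first) and Ben, who alternately pick a symbol from $S$ and append it to the end of the current sequence (initially empty). Whenever the appended symbol creates a repetition, the repeated block (the second half $x_1\dots x_h$ of the repetition, i.e. the last $h$ terms) is immediately erased, and the next player continues extending the remaining sequence. Thus after each move the current sequence is nonrepetitive. -}

module Defs where

open import Data.Nat using (ℕ; zero; suc; _+_; _*_; _∸_; _≤?_)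
open import Data.Fin using (Fin)
open import Data.Fin.Properties using () renaming (_≟_ to _≟ᶠ_)
open import Data.List using (List; []; _∷_; _∷ʳ_; length; take; drop; foldl)
open import Data.List.Properties using (≡-dec)
open import Data.Bool using (Bool; true; false; if_then_else_)
open import Relation.Nullary using (yes; no)

Sym : Set
Sym = Fin 8

_≟ₗ_ : (u v : List Sym) → _
_≟ₗ_ = ≡-dec _≟ᶠ_

suffixRep : ℕ → List Sym → Bool
suffixRep zero w = false
suffixRep h@(suc _) w with (2 * h) ≤? length w
... | no _ = false
... | yes _ with take h (drop (length w ∸ 2 * h) w) ≟ₗ drop (length w ∸ h) w
...   | yes _ = true
...   | no _  = false

-- Erase step: look for a repetition at the end of w (sizes h = 1, 2, …, in
-- increasing order); if one of size h is found, erase the last h terms.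
-- (When w is a nonrepetitive sequence extended by one symbol, such a
-- repetition is necessarily a suffix, and it is unique.)
eraseSearch : ℕ → ℕ → List Sym → List Sym
eraseSearch h zero w = w
eraseSearch h (suc k) w =
  if suffixRep h w then take (length w ∸ h) w else eraseSearch (suc h) k w

erase : List Sym → List Sym
erase w = eraseSearch 1 (length w) w

move : List Sym → Sym → List Sym
move w x = erase (w ∷ʳ x)

current : List Sym → List Sym
current ms = foldl move [] ms

-- A strategy maps the history of moves so far to the next symbol.
Strategy : Set
Strategy = List Sym → Sym

history : Strategy → Strategy → ℕ → List Sym
history ann ben zero = []
history ann ben (suc k) = history ann ben k ∷ʳ player k (history ann ben k)
  where
  isEven : ℕ → Bool
  isEven zero = true
  isEven (suc zero) = false
  isEven (suc (suc n)) = isEven n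
  player : ℕ → Strategy
  player k = if isEven k then ann else ben

position : Strategy → Strategy → ℕ → List Sym
position ann ben k = current (history ann ben k)

{-# OPTIONS --safe #-}

-- Ann keeps a potential of the current word small. A threat against a word is a
-- prefix p of it together with a square of half-length h ≥ 4 whose first half ends
-- p and whose second half has been started right after p; completing the square
-- throws the game back to p. The potential of w is (1/8)^|w| plus, for every threat,
-- (4/7)^(symbols still missing) times the potential of p.
--
-- Since the next symbol continues a given threat in only one way, the potentials of
-- all one-symbol extensions of w add up to at most κ = 219/100 times that of w. Ann
-- avoids the last three symbols, so she has at least five candidates, and the best of
-- them scales the potential by at most κ/5, while a move of Ben scales it by at most
-- κ. Squares of half-length below 4 never hurt: Ann cannot close them, and Ben can
-- close only those of half-length 1, which leave the word as it was. As κ²/5 < 1 the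
-- potential tends to 0, but it is at least (1/8)^|w|, so |w| is unbounded.

module Submission where

open import Defs
import Data.Rational as ℚ
open import Algebra.Definitions.RawMonoid ℚ.+-0-rawMonoid using () renaming (_×_ to _·_)
open import Algebra.Definitions.RawSemiring ℚ.+-*-rawSemiring using (_^_)
open import Data.Bool using (Bool; true; false; if_then_else_)
open import Data.Fin using (Fin)
open import Data.Fin.Properties using (all?) renaming (_≟_ to _≟ᶠ_)
open import Data.Integer using (+_)
open import Data.List using (List; []; _∷_; _∷ʳ_; _++_; _ʳ++_; allFin; drop; filter;
  length; reverse; take)
open import Data.List.Membership.Propositional using (_∈_)
open import Data.List.Membership.Propositional.Properties using (∈-++⁺ˡ; ∈-++⁺ʳ; ∈-filter⁻)
open import Data.List.Properties using (++-assoc; drop-drop; foldl-∷ʳ; length-++; length-drop;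
  length-filter; length-reverse; reverse-++; reverse-involutive; take++drop≡id)
open import Data.List.Relation.Unary.All using (All; []; _∷_)
import Data.List.Relation.Unary.All as All
open import Data.List.Relation.Unary.All.Properties using (++⁺)
open import Data.List.Relation.Unary.Any using (here; there)
open import Data.List.Relation.Unary.AllPairs using ([]; _∷_)
open import Data.List.Relation.Unary.Unique.Propositional using (Unique)
open import Data.List.Relation.Unary.Unique.Propositional.Properties using (allFin⁺; filter⁺)
open import Data.Nat using (ℕ; zero; suc; _≤_; _>_; z≤n; s≤s)
import Data.Nat as ℕ
import Data.Nat.Properties as ℕₚ
open import Data.Product using (Σ; ∃; ∃₂; _×_; _,_; proj₁; proj₂)
open import Data.Rational using (ℚ; 0ℚ; 1ℚ; _/_; NonNegative; nonNegative)
  renaming (_+_ to _+ℚ_; _*_ to _*ℚ_; _≤_ to _≤ℚ_)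
import Data.Rational.Properties as ℚₚ
open import Data.Rational.Solver using (module +-*-Solver)
open import Function using (_∘_)
open import Relation.Binary.PropositionalEquality using (_≡_; _≢_; refl; sym; trans; cong; cong₂;
  subst; module ≡-Reasoning)
open import Relation.Nullary using (yes; no; does; ¬?; Dec; from-yes; from-no; contradiction)
open import Relation.Nullary.Decidable using (True; dec-false; toWitness)

-- Squares and erasing

take-length-++ : ∀ {A : Set} (u v : List A) → take (length u) (u ++ v) ≡ u
take-length-++ [] v = refl
take-length-++ (x ∷ u) v = cong (x ∷_) (take-length-++ u v)

suffixRep-square : ∀ h w → suffixRep (suc h) w ≡ true →
  ∃₂ λ p u → u ≢ [] × w ≡ p ++ u ++ u × take (length w ℕ.∸ suc h) w ≡ p ++ u
suffixRep-square h w rep with (2 ℕ.* suc h) ℕ.≤? length w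
... | yes 2h≤w
  with take (suc h) (drop (length w ℕ.∸ 2 ℕ.* suc h) w) ≟ₗ drop (length w ℕ.∸ suc h) w
... | yes same = p , u , u≢[] , w≡ , take≡
  where
  l = length w
  p = take (l ℕ.∸ 2 ℕ.* suc h) w
  m = drop (l ℕ.∸ 2 ℕ.* suc h) w
  u = drop (l ℕ.∸ suc h) w

  h≤l : suc h ≤ l
  h≤l = ℕₚ.≤-trans (ℕₚ.m≤m+n (suc h) _) 2h≤w

  ∣u∣ : length u ≡ suc h
  ∣u∣ = trans (length-drop (l ℕ.∸ suc h) w) (ℕₚ.m∸[m∸n]≡n h≤l)

  u≢[] : u ≢ []
  u≢[] u≡[] = contradiction (trans (sym ∣u∣) (cong length u≡[])) λ ()

  -- Truncated subtraction is exact here because `2h≤w` holds.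
  offset : l ℕ.∸ 2 ℕ.* suc h ℕ.+ suc h ≡ l ℕ.∸ suc h
  offset = begin
    l ℕ.∸ 2 ℕ.* suc h ℕ.+ suc h
      ≡⟨ cong (λ k → l ℕ.∸ (suc h ℕ.+ k) ℕ.+ suc h) (ℕₚ.+-identityʳ (suc h)) ⟩
    l ℕ.∸ (suc h ℕ.+ suc h) ℕ.+ suc h
      ≡⟨ cong (ℕ._+ suc h) (ℕₚ.∸-+-assoc l (suc h) (suc h)) ⟨
    l ℕ.∸ suc h ℕ.∸ suc h ℕ.+ suc h
      ≡⟨ ℕₚ.m∸n+n≡m (ℕₚ.m+n≤o⇒m≤o∸n (suc h)
           (subst (λ k → suc h ℕ.+ k ≤ l) (ℕₚ.+-identityʳ (suc h)) 2h≤w)) ⟩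
    l ℕ.∸ suc h ∎
    where open ≡-Reasoning

  w≡ : w ≡ p ++ u ++ u
  w≡ = begin
    w
      ≡⟨ take++drop≡id (l ℕ.∸ 2 ℕ.* suc h) w ⟨
    p ++ m
      ≡⟨ cong (p ++_) (take++drop≡id (suc h) m) ⟨
    p ++ take (suc h) m ++ drop (suc h) m
      ≡⟨ cong₂ (λ a b → p ++ a ++ b) same
           (trans (drop-drop (l ℕ.∸ 2 ℕ.* suc h) (suc h) w) (cong (λ k → drop k w) offset)) ⟩
    p ++ u ++ u ∎
    where open ≡-Reasoning

  ∣pu∣ : l ℕ.∸ suc h ≡ length (p ++ u)
  ∣pu∣ = begin
    l ℕ.∸ suc h
      ≡⟨ cong₂ ℕ._∸_ (trans (cong length (trans w≡ (sym (++-assoc p u u)))) (length-++ (p ++ u)))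
                     (sym ∣u∣) ⟩
    length (p ++ u) ℕ.+ length u ℕ.∸ length u
      ≡⟨ ℕₚ.m+n∸n≡m (length (p ++ u)) (length u) ⟩
    length (p ++ u) ∎
    where open ≡-Reasoning

  take≡ : take (l ℕ.∸ suc h) w ≡ p ++ u
  take≡ = begin
    take (l ℕ.∸ suc h) w
      ≡⟨ cong₂ take ∣pu∣ (trans w≡ (sym (++-assoc p u u))) ⟩
    take (length (p ++ u)) ((p ++ u) ++ u)
      ≡⟨ take-length-++ (p ++ u) u ⟩
    p ++ u ∎
    where open ≡-Reasoning

-- From here on words are reversed: the most recent symbol comes first.
data Erased (r : List Sym) : List Sym → Set where
  kept   : Erased r r
  square : ∀ s q → s ≢ [] → r ≡ s ++ s ++ q → Erased r (s ++ q)

eraseSearch-erased : ∀ h k w → Erased (reverse w) (reverse (eraseSearch (suc h) k w))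
eraseSearch-erased h zero w = kept
eraseSearch-erased h (suc k) w with suffixRep (suc h) w in rep
... | false = eraseSearch-erased (suc h) k w
... | true with p , u , u≢[] , w≡ , take≡ ← suffixRep-square h w rep
  = subst (Erased (reverse w)) (sym (trans (cong reverse take≡) (reverse-++ p u)))
      (square (reverse u) (reverse p)
        (λ eq → u≢[] (trans (sym (reverse-involutive u)) (cong reverse eq)))
        (trans (cong reverse w≡)
          (trans (reverse-++ p (u ++ u))
            (trans (cong (_++ reverse p) (reverse-++ u u))
              (++-assoc (reverse u) (reverse u) (reverse p))))))

move-erased : ∀ w x → Erased (x ∷ reverse w) (reverse (move w x))
move-erased w x =
  subst (λ r → Erased r (reverse (move w x))) (reverse-++ w (x ∷ []))
    (eraseSearch-erased 0 (length (w ∷ʳ x)) (w ∷ʳ x))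

-- Sums of rationals

respˡ-≤ : ∀ {x y z} → x ≡ y → x ≤ℚ z → y ≤ℚ z
respˡ-≤ refl x≤z = x≤z

x≤x+y : ∀ x {y} → 0ℚ ≤ℚ y → x ≤ℚ x +ℚ y
x≤x+y x 0≤y = respˡ-≤ (ℚₚ.+-identityʳ x) (ℚₚ.+-monoʳ-≤ x 0≤y)

y≤x+y : ∀ {x} y → 0ℚ ≤ℚ x → y ≤ℚ x +ℚ y
y≤x+y y 0≤x = respˡ-≤ (ℚₚ.+-identityˡ y) (ℚₚ.+-monoˡ-≤ y 0≤x)

∑ : ∀ {A : Set} → (A → ℚ) → List A → ℚ
∑ f [] = 0ℚ
∑ f (x ∷ xs) = f x +ℚ ∑ f xs

module _ {A : Set} where

  ∑-++ : ∀ (f : A → ℚ) xs ys → ∑ f (xs ++ ys) ≡ ∑ f xs +ℚ ∑ f ys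
  ∑-++ f [] ys = sym (ℚₚ.+-identityˡ _)
  ∑-++ f (x ∷ xs) ys = trans (cong (f x +ℚ_) (∑-++ f xs ys)) (sym (ℚₚ.+-assoc (f x) _ _))

  ∑-+ : ∀ (f g : A → ℚ) xs → ∑ (λ x → f x +ℚ g x) xs ≡ ∑ f xs +ℚ ∑ g xs
  ∑-+ f g [] = refl
  ∑-+ f g (x ∷ xs) = trans (cong (f x +ℚ g x +ℚ_) (∑-+ f g xs))
    (solve 4 (λ a b c d → (a :+ b) :+ (c :+ d) := (a :+ c) :+ (b :+ d)) refl
      (f x) (g x) (∑ f xs) (∑ g xs))
    where open +-*-Solver

  ∑-const : ∀ (c : ℚ) (xs : List A) → ∑ (λ _ → c) xs ≡ length xs · c
  ∑-const c [] = refl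
  ∑-const c (x ∷ xs) = cong (c +ℚ_) (∑-const c xs)

  ∑-zero : ∀ {f : A → ℚ} {xs} → All (λ x → f x ≡ 0ℚ) xs → ∑ f xs ≡ 0ℚ
  ∑-zero [] = refl
  ∑-zero (fx≡0 ∷ fxs≡0) = cong₂ _+ℚ_ fx≡0 (∑-zero fxs≡0)

  ∑-cong : ∀ {f g : A → ℚ} → (∀ x → f x ≡ g x) → ∀ xs → ∑ f xs ≡ ∑ g xs
  ∑-cong f≗g [] = refl
  ∑-cong f≗g (x ∷ xs) = cong₂ _+ℚ_ (f≗g x) (∑-cong f≗g xs)

  ∑-nonNeg : ∀ {f : A → ℚ} {xs} → All (λ x → 0ℚ ≤ℚ f x) xs → 0ℚ ≤ℚ ∑ f xs
  ∑-nonNeg [] = ℚₚ.≤-refl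
  ∑-nonNeg (0≤fx ∷ 0≤fxs) = ℚₚ.+-mono-≤ 0≤fx (∑-nonNeg 0≤fxs)

  ∈⇒≤∑ : ∀ {f : A → ℚ} {x xs} → All (λ x → 0ℚ ≤ℚ f x) xs → x ∈ xs → f x ≤ℚ ∑ f xs
  ∈⇒≤∑ (_ ∷ 0≤fxs) (here refl) = x≤x+y _ (∑-nonNeg 0≤fxs)
  ∈⇒≤∑ (0≤fy ∷ 0≤fxs) (there x∈xs) = ℚₚ.≤-trans (∈⇒≤∑ 0≤fxs x∈xs) (y≤x+y _ 0≤fy)

  below-average : ∀ {f : A → ℚ} {m} n {xs} → All (λ x → 0ℚ ≤ℚ f x) xs → suc n ≤ length xs →
    ∑ f xs ≤ℚ suc n · m → ∃ λ x → x ∈ xs × f x ≤ℚ m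
  below-average {f} {m} n {x ∷ xs} (0≤fx ∷ 0≤fxs) (s≤s n≤) ∑≤ with f x ℚ.≤? m
  ... | yes fx≤m = x , here refl , fx≤m
  below-average {f} {m} zero {x ∷ xs} (_ ∷ 0≤fxs) _ ∑≤ | no fx≰m =
    contradiction (ℚₚ.≤-trans (x≤x+y (f x) (∑-nonNeg 0≤fxs))
                    (ℚₚ.≤-trans ∑≤ (ℚₚ.≤-reflexive (ℚₚ.+-identityʳ m)))) fx≰m
  below-average {f} {m} (suc n) {x ∷ xs} (_ ∷ 0≤fxs) (s≤s n≤) ∑≤ | no fx≰m
    with below-average n 0≤fxs n≤ rest
    where
    rest : ∑ f xs ≤ℚ suc n · m
    rest = ℚₚ.≮⇒≥ λ lt →
      ℚₚ.<-irrefl refl (ℚₚ.<-≤-trans (ℚₚ.+-mono-< (ℚₚ.≰⇒> fx≰m) lt) ∑≤)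
  ... | y , y∈xs , fy≤m = y , there y∈xs , fy≤m

*-nonNeg : ∀ {p q} → 0ℚ ≤ℚ p → 0ℚ ≤ℚ q → 0ℚ ≤ℚ p *ℚ q
*-nonNeg {p} {q} 0≤p 0≤q =
  subst (_≤ℚ p *ℚ q) (ℚₚ.*-zeroʳ p) (ℚₚ.*-monoˡ-≤-nonNeg p {{nonNegative 0≤p}} 0≤q)

·-monoˡ-≤ : ∀ {c m n} → 0ℚ ≤ℚ c → m ≤ n → m · c ≤ℚ n · c
·-monoˡ-≤ {c} {n = n} 0≤c z≤n = 0≤n·c n
  where
  0≤n·c : ∀ n → 0ℚ ≤ℚ n · c
  0≤n·c zero = ℚₚ.≤-refl
  0≤n·c (suc n) = ℚₚ.+-mono-≤ 0≤c (0≤n·c n)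
·-monoˡ-≤ {c} 0≤c (s≤s m≤n) = ℚₚ.+-monoʳ-≤ c (·-monoˡ-≤ 0≤c m≤n)

-- Threats

-- The symbols still to be played, in playing order, and the potential of the word
-- that is left once they have been played.
Threat : Set
Threat = List Sym × ℚ

-- The ratio Y = 4/7 gives the growth bound 1/Y + Y^3/(1 - Y) = 1285/588, below the square root of 5
-- as a round of two moves requires.
weight : List Sym → ℚ
weight [] = 1ℚ
weight (_ ∷ s) = + 4 / 7 *ℚ weight s

cost : Threat → ℚ
cost (s , v) = weight s *ℚ v

-- A completed threat `([] , v)` lasts until the next symbol. It has weight 1, so the word that
-- closes the square bears the whole potential `v` of the word left by the erasure.
advance : Sym → List Threat → List Threat
advance x [] = []
advance x (([] , v) ∷ ts) = advance x ts
advance x ((y ∷ s , v) ∷ ts) with x ≟ᶠ y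
... | yes _ = (s , v) ∷ advance x ts
... | no  _ = advance x ts

-- Walking back in time through the reversed word conses ever older symbols, which puts each half
-- into playing order.
suffixThreats : List Sym → List Sym → ℚ → List Threat
suffixThreats s [] v = []
suffixThreats s (x ∷ r) v = (x ∷ s , v) ∷ suffixThreats (x ∷ s) r v

-- Packing the three newest symbols beforehand gives every half length at least 4.
fresh : List Sym → ℚ → List Threat
fresh (c ∷ b ∷ a ∷ r) v = suffixThreats (a ∷ b ∷ c ∷ []) r v
fresh _ _ = []

mutual
  pending : List Sym → List Threat
  pending [] = []
  pending (x ∷ r) = advance x (live r)

  -- A threat born at `r` is worth `potential r`, so `potential r` counts only `pending r`; the new
  -- threat enters once its first symbol is played. This keeps the recursion well founded.
  live : List Sym → List Threat
  live r = fresh r (potential r) ++ pending r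

  potential : List Sym → ℚ
  potential r = (+ 1 / 8) ^ length r +ℚ ∑ cost (pending r)

NonNegThreat : Threat → Set
NonNegThreat (_ , v) = 0ℚ ≤ℚ v

0≤weight : ∀ s → 0ℚ ≤ℚ weight s
0≤weight [] = ℚₚ.nonNegative⁻¹ 1ℚ
0≤weight (_ ∷ s) = *-nonNeg (ℚₚ.nonNegative⁻¹ (+ 4 / 7)) (0≤weight s)

cost-nonNeg : ∀ {ts} → All NonNegThreat ts → All (λ t → 0ℚ ≤ℚ cost t) ts
cost-nonNeg = All.map λ {t} → *-nonNeg (0≤weight (proj₁ t))

advance-nonNeg : ∀ x {ts} → All NonNegThreat ts → All NonNegThreat (advance x ts)
advance-nonNeg x [] = []
advance-nonNeg x {([] , v) ∷ ts} (_ ∷ 0≤ts) = advance-nonNeg x 0≤ts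
advance-nonNeg x {(y ∷ s , v) ∷ ts} (0≤v ∷ 0≤ts) with x ≟ᶠ y
... | yes _ = 0≤v ∷ advance-nonNeg x 0≤ts
... | no  _ = advance-nonNeg x 0≤ts

suffixThreats-nonNeg : ∀ s r {v} → 0ℚ ≤ℚ v → All NonNegThreat (suffixThreats s r v)
suffixThreats-nonNeg s [] 0≤v = []
suffixThreats-nonNeg s (x ∷ r) 0≤v = 0≤v ∷ suffixThreats-nonNeg (x ∷ s) r 0≤v

fresh-nonNeg : ∀ r {v} → 0ℚ ≤ℚ v → All NonNegThreat (fresh r v)
fresh-nonNeg [] 0≤v = []
fresh-nonNeg (_ ∷ []) 0≤v = []
fresh-nonNeg (_ ∷ _ ∷ []) 0≤v = []
fresh-nonNeg (c ∷ b ∷ a ∷ r) 0≤v = suffixThreats-nonNeg (a ∷ b ∷ c ∷ []) r 0≤v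

0≤⅛^ : ∀ n → 0ℚ ≤ℚ (+ 1 / 8) ^ n
0≤⅛^ zero = ℚₚ.nonNegative⁻¹ 1ℚ
0≤⅛^ (suc n) = *-nonNeg (ℚₚ.nonNegative⁻¹ (+ 1 / 8)) (0≤⅛^ n)

mutual
  pending-nonNeg : ∀ r → All NonNegThreat (pending r)
  pending-nonNeg [] = []
  pending-nonNeg (x ∷ r) = advance-nonNeg x (live-nonNeg r)

  live-nonNeg : ∀ r → All NonNegThreat (live r)
  live-nonNeg r = ++⁺ (fresh-nonNeg r (potential-nonNeg r)) (pending-nonNeg r)

  potential-nonNeg : ∀ r → 0ℚ ≤ℚ potential r
  potential-nonNeg r = ℚₚ.+-mono-≤ (0≤⅛^ (length r)) (∑-nonNeg (cost-nonNeg (pending-nonNeg r)))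

-- Growth of the potential under one more symbol

gain : Sym → Threat → ℚ
gain x ([] , v) = 0ℚ
gain x (y ∷ s , v) = if does (x ≟ᶠ y) then cost (s , v) else 0ℚ

∑-advance : ∀ x ts → ∑ cost (advance x ts) ≡ ∑ (gain x) ts
∑-advance x [] = refl
∑-advance x (([] , v) ∷ ts) = trans (∑-advance x ts) (sym (ℚₚ.+-identityˡ _))
∑-advance x ((y ∷ s , v) ∷ ts) with x ≟ᶠ y
... | yes _ = cong (cost (s , v) +ℚ_) (∑-advance x ts)
... | no  _ = trans (∑-advance x ts) (sym (ℚₚ.+-identityˡ _))

∑-indicator : ∀ {n} (y : Fin n) {c} → 0ℚ ≤ℚ c → ∀ {xs} → Unique xs →
  ∑ (λ x → if does (x ≟ᶠ y) then c else 0ℚ) xs ≤ℚ c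
∑-indicator y 0≤c [] = 0≤c
∑-indicator y {c} 0≤c {x ∷ xs} (x∉xs ∷ xs!) with x ≟ᶠ y
... | yes refl = ℚₚ.≤-reflexive
  (trans (cong (c +ℚ_) (∑-zero (All.map vanishes x∉xs))) (ℚₚ.+-identityʳ c))
  where
  vanishes : ∀ {z} → x ≢ z → (if does (z ≟ᶠ x) then c else 0ℚ) ≡ 0ℚ
  vanishes {z} x≢z = cong (λ b → if b then c else 0ℚ) (dec-false (z ≟ᶠ x) (x≢z ∘ sym))
... | no _ = subst (_≤ℚ c) (sym (ℚₚ.+-identityˡ _)) (∑-indicator y 0≤c xs!)

-- At most one symbol of `xs` continues the threat, and playing it removes one factor 4/7.
∑-gain : ∀ t → NonNegThreat t → ∀ {xs} → Unique xs → ∑ (λ x → gain x t) xs ≤ℚ + 7 / 4 *ℚ cost t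
∑-gain t@([] , v) 0≤v {xs} xs! =
  respˡ-≤ (sym (∑-zero {xs = xs} (All.universal (λ _ → refl) xs)))
    (*-nonNeg (ℚₚ.nonNegative⁻¹ (+ 7 / 4)) (*-nonNeg (0≤weight []) 0≤v))
∑-gain t@(y ∷ s , v) 0≤v {xs} xs! =
  subst (∑ (λ x → gain x t) xs ≤ℚ_)
    (solve 2 (λ w v → w :* v := con (+ 7 / 4) :* (con (+ 4 / 7) :* w :* v)) refl (weight s) v)
    (∑-indicator y (*-nonNeg (0≤weight s) 0≤v) xs!)
  where open +-*-Solver

∑∑-advance : ∀ {ts} → All NonNegThreat ts → ∀ {xs} → Unique xs →
  ∑ (λ x → ∑ cost (advance x ts)) xs ≤ℚ + 7 / 4 *ℚ ∑ cost ts
∑∑-advance {ts} 0≤ts {xs} xs! = respˡ-≤ (∑-cong (λ x → sym (∑-advance x ts)) xs) (go 0≤ts)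
  where
  open ℚₚ.≤-Reasoning
  go : ∀ {ts} → All NonNegThreat ts → ∑ (λ x → ∑ (gain x) ts) xs ≤ℚ + 7 / 4 *ℚ ∑ cost ts
  go [] = ℚₚ.≤-reflexive (∑-zero {xs = xs} (All.universal (λ _ → refl) xs))
  go {t ∷ ts} (0≤t ∷ 0≤ts) = begin
    ∑ (λ x → gain x t +ℚ ∑ (gain x) ts) xs
      ≡⟨ ∑-+ (λ x → gain x t) (λ x → ∑ (gain x) ts) xs ⟩
    ∑ (λ x → gain x t) xs +ℚ ∑ (λ x → ∑ (gain x) ts) xs
      ≤⟨ ℚₚ.+-mono-≤ (∑-gain t 0≤t xs!) (go 0≤ts) ⟩
    + 7 / 4 *ℚ cost t +ℚ + 7 / 4 *ℚ ∑ cost ts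
      ≡⟨ ℚₚ.*-distribˡ-+ (+ 7 / 4) (cost t) (∑ cost ts) ⟨
    + 7 / 4 *ℚ ∑ cost (t ∷ ts) ∎

-- 4/3 = Y / (1 − Y) for Y = 4/7: a geometric series.
∑-suffixThreats : ∀ s r {v} → 0ℚ ≤ℚ v → ∑ cost (suffixThreats s r v) ≤ℚ + 4 / 3 *ℚ (weight s *ℚ v)
∑-suffixThreats s [] 0≤v = *-nonNeg (ℚₚ.nonNegative⁻¹ (+ 4 / 3)) (*-nonNeg (0≤weight s) 0≤v)
∑-suffixThreats s (x ∷ r) {v} 0≤v = begin
  + 4 / 7 *ℚ weight s *ℚ v +ℚ ∑ cost (suffixThreats (x ∷ s) r v)
    ≤⟨ ℚₚ.+-monoʳ-≤ (weight (x ∷ s) *ℚ v) (∑-suffixThreats (x ∷ s) r 0≤v) ⟩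
  + 4 / 7 *ℚ weight s *ℚ v +ℚ + 4 / 3 *ℚ (+ 4 / 7 *ℚ weight s *ℚ v)
    ≡⟨ solve 2 (λ w v → con (+ 4 / 7) :* w :* v :+ con (+ 4 / 3) :* (con (+ 4 / 7) :* w :* v)
                         := con (+ 4 / 3) :* (w :* v)) refl (weight s) v ⟩
  + 4 / 3 *ℚ (weight s *ℚ v) ∎
  where
  open ℚₚ.≤-Reasoning
  open +-*-Solver

∑-fresh : ∀ r {v} → 0ℚ ≤ℚ v → ∑ cost (fresh r v) ≤ℚ + 256 / 1029 *ℚ v
∑-fresh [] 0≤v = *-nonNeg (ℚₚ.nonNegative⁻¹ (+ 256 / 1029)) 0≤v
∑-fresh (_ ∷ []) 0≤v = *-nonNeg (ℚₚ.nonNegative⁻¹ (+ 256 / 1029)) 0≤v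
∑-fresh (_ ∷ _ ∷ []) 0≤v = *-nonNeg (ℚₚ.nonNegative⁻¹ (+ 256 / 1029)) 0≤v
∑-fresh (c ∷ b ∷ a ∷ r) {v} 0≤v =
  -- 256/1029 is 4/3 times (4/7)^3, the weight of the three packed symbols.
  ℚₚ.≤-trans (∑-suffixThreats (a ∷ b ∷ c ∷ []) r 0≤v)
    (ℚₚ.≤-reflexive (sym (ℚₚ.*-assoc (+ 4 / 3) (+ 64 / 343) v)))

κ : ℚ
κ = + 219 / 100

∑-potential : ∀ r {xs} → Unique xs → length xs ≤ 8 →
  ∑ (λ x → potential (x ∷ r)) xs ≤ℚ κ *ℚ potential r
∑-potential r {xs} xs! ∣xs∣≤8 = begin
  ∑ (λ x → ρ' +ℚ ∑ cost (advance x (live r))) xs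
    ≡⟨ ∑-+ (λ _ → ρ') (λ x → ∑ cost (advance x (live r))) xs ⟩
  ∑ (λ _ → ρ') xs +ℚ ∑ (λ x → ∑ cost (advance x (live r))) xs
    ≤⟨ ℚₚ.+-mono-≤ bases (∑∑-advance (live-nonNeg r) xs!) ⟩
  ρ +ℚ + 7 / 4 *ℚ ∑ cost (live r)
    ≡⟨ cong (λ c → ρ +ℚ + 7 / 4 *ℚ c) (∑-++ cost (fresh r (potential r)) (pending r)) ⟩
  ρ +ℚ + 7 / 4 *ℚ (∑ cost (fresh r (potential r)) +ℚ Θ)
    -- Inflating the base term by 7/4 makes everything a multiple of `ρ +ℚ Θ`, which is
    -- `potential r`: 7/4 times (1 + 256/1029) is 1285/588.
    ≤⟨ ℚₚ.+-mono-≤ ρ≤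
         (ℚₚ.*-monoˡ-≤-nonNeg (+ 7 / 4) (ℚₚ.+-monoˡ-≤ Θ (∑-fresh r (potential-nonNeg r)))) ⟩
  + 7 / 4 *ℚ ρ +ℚ + 7 / 4 *ℚ (+ 256 / 1029 *ℚ (ρ +ℚ Θ) +ℚ Θ)
    ≡⟨ solve 2 (λ ρ Θ → con (+ 7 / 4) :* ρ :+ con (+ 7 / 4) :* (con (+ 256 / 1029) :* (ρ :+ Θ) :+ Θ)
                         := con (+ 1285 / 588) :* (ρ :+ Θ)) refl ρ Θ ⟩
  + 1285 / 588 *ℚ potential r
    ≤⟨ ℚₚ.*-monoʳ-≤-nonNeg (potential r) {{nonNegative (potential-nonNeg r)}}
         (from-yes (+ 1285 / 588 ℚ.≤? κ)) ⟩
  κ *ℚ potential r ∎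
  where
  open ℚₚ.≤-Reasoning
  open +-*-Solver
  ρ  = (+ 1 / 8) ^ length r
  ρ' = + 1 / 8 *ℚ ρ
  Θ  = ∑ cost (pending r)

  -- The base 1/8 is chosen so that eight extensions share out exactly `ρ`.
  bases : ∑ (λ _ → ρ') xs ≤ℚ ρ
  bases = begin
    ∑ (λ _ → ρ') xs ≡⟨ ∑-const ρ' xs ⟩
    length xs · ρ'  ≤⟨ ·-monoˡ-≤ (0≤⅛^ (suc (length r))) ∣xs∣≤8 ⟩
    8 · ρ'          ≡⟨ solve 1 (λ ρ → let ρ' = con (+ 1 / 8) :* ρ in
                         ρ' :+ (ρ' :+ (ρ' :+ (ρ' :+ (ρ' :+ (ρ' :+ (ρ' :+ (ρ' :+ con 0ℚ))))))) := ρ)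
                         refl ρ ⟩
    ρ               ∎

  ρ≤ : ρ ≤ℚ + 7 / 4 *ℚ ρ
  ρ≤ = respˡ-≤ (ℚₚ.*-identityˡ ρ)
    (ℚₚ.*-monoʳ-≤-nonNeg ρ {{nonNegative (0≤⅛^ (length r))}} (from-yes (1ℚ ℚ.≤? + 7 / 4)))

potential-∷ : ∀ x r → potential (x ∷ r) ≤ℚ κ *ℚ potential r
potential-∷ x r = respˡ-≤ (ℚₚ.+-identityʳ _) (∑-potential r {x ∷ []} ([] ∷ []) (s≤s z≤n))

-- Closing a square

∈-suffixThreats : ∀ t s q {v} → t ≢ [] → (t ʳ++ s , v) ∈ suffixThreats s (t ++ q) v
∈-suffixThreats [] s q t≢[] = contradiction refl t≢[]
∈-suffixThreats (x ∷ []) s q t≢[] = here refl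
∈-suffixThreats (x ∷ y ∷ t) s q t≢[] = there (∈-suffixThreats (y ∷ t) (x ∷ s) q λ ())

∈-advance : ∀ x s {v ts} → (x ∷ s , v) ∈ ts → (s , v) ∈ advance x ts
∈-advance x s (here refl) with x ≟ᶠ x
... | yes _ = here refl
... | no x≢x = contradiction refl x≢x
∈-advance x s {ts = ([] , _) ∷ ts} (there t∈ts) = ∈-advance x s t∈ts
∈-advance x s {ts = (y ∷ _ , _) ∷ ts} (there t∈ts) with x ≟ᶠ y
... | yes _ = there (∈-advance x s t∈ts)
... | no  _ = ∈-advance x s t∈ts

-- `t` is newest first and `t ʳ++ s` is in playing order, so playing `t` consumes exactly the front
-- of the threat.
∈-live : ∀ t s r {v} → (t ʳ++ s , v) ∈ live r → (s , v) ∈ live (t ++ r)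
∈-live [] s r t∈ = t∈
∈-live (x ∷ t) s r t∈ =
  ∈-++⁺ʳ (fresh (x ∷ t ++ r) _) (∈-advance x s (∈-live t (x ∷ s) r t∈))

-- The threat to repeat `s` is born at `s ++ q` with value `potential (s ++ q)`. Playing `s` again
-- completes it, making that value one summand of the right-hand side.
potential-square : ∀ a b c d t q → let s = a ∷ b ∷ c ∷ d ∷ t in
  potential (s ++ q) ≤ℚ potential (s ++ s ++ q)
potential-square a b c d t q = ℚₚ.≤-trans
  (subst (_≤ℚ ∑ cost (pending (s ++ s ++ q))) (ℚₚ.*-identityˡ v)
    (∈⇒≤∑ (cost-nonNeg (pending-nonNeg (s ++ s ++ q)))
      -- The last symbol goes through `∈-advance`, so that the threat lands in `pending`, where the
      -- potential counts it.
      (∈-advance a [] (∈-live (b ∷ c ∷ d ∷ t) (a ∷ []) (s ++ q)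
        (∈-++⁺ˡ (∈-suffixThreats (d ∷ t) (c ∷ b ∷ a ∷ []) q λ ()))))))
  (y≤x+y _ (0≤⅛^ (length (s ++ s ++ q))))
  where
  s = a ∷ b ∷ c ∷ d ∷ t
  v = potential (s ++ q)

-- The two players

Novel : Sym → List Sym → Set
Novel x r = All (x ≢_) (take 3 r)

novel? : ∀ r x → Dec (Novel x r)
novel? r x = All.all? (λ y → ¬? (x ≟ᶠ y)) (take 3 r)

candidates : List Sym → List Sym
candidates r = filter (novel? r) (allFin 8)

5≤∣candidates∣ : ∀ r → 5 ≤ length (candidates r)
5≤∣candidates∣ [] = from-yes (5 ℕ.≤? 8)
5≤∣candidates∣ (a ∷ []) = from-yes (all? λ a → 5 ℕ.≤? length (candidates (a ∷ []))) a
5≤∣candidates∣ (a ∷ b ∷ []) =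
  from-yes (all? λ a → all? λ b → 5 ℕ.≤? length (candidates (a ∷ b ∷ []))) a b
5≤∣candidates∣ (a ∷ b ∷ c ∷ r) =
  -- `novel?` inspects three symbols only, so 512 evaluated cases cover every longer word.
  from-yes (all? λ a → all? λ b → all? λ c → 5 ℕ.≤? length (candidates (a ∷ b ∷ c ∷ []))) a b c

good-candidate : ∀ r → ∃ λ x → Novel x r × potential (x ∷ r) ≤ℚ + 219 / 500 *ℚ potential r
good-candidate r =
  let x , x∈ , small = below-average 4
        (All.universal (λ x → potential-nonNeg (x ∷ r)) (candidates r))
        (5≤∣candidates∣ r)
        (ℚₚ.≤-trans (∑-potential r (filter⁺ (novel? r) (allFin⁺ 8))
                      (length-filter (novel? r) (allFin 8)))
          (ℚₚ.≤-reflexive (solve 1 (λ v → con κ :* v := let m = con (+ 219 / 500) :* v in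
            m :+ (m :+ (m :+ (m :+ (m :+ con 0ℚ))))) refl (potential r))))
  in x , proj₂ (∈-filter⁻ (novel? r) {xs = allFin 8} x∈) , small
  where open +-*-Solver

data Lively : List Sym → Set where
  lively : ∀ {x r} → Novel x r → Lively (x ∷ r)

-- A square of half-length h closed by `x` also has `x` h places earlier, which novelty excludes for
-- h up to 3. Longer squares are paid for by `potential-square`.
erased-novel : ∀ {x r r'} → Novel x r → Erased (x ∷ r) r' →
  Lively r' × potential r' ≤ℚ potential (x ∷ r)
erased-novel x-new kept = lively x-new , ℚₚ.≤-refl
erased-novel x-new (square [] q s≢[] eq) = contradiction refl s≢[]
erased-novel (x≢ ∷ _) (square (a ∷ []) q _ refl) = contradiction refl x≢
erased-novel (_ ∷ x≢ ∷ _) (square (a ∷ b ∷ []) q _ refl) = contradiction refl x≢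
erased-novel (_ ∷ _ ∷ x≢ ∷ _) (square (a ∷ b ∷ c ∷ []) q _ refl) = contradiction refl x≢
-- The symbol left on top by the erasure is again distinct from the three before it,
-- because the erased half has length at least 4.
erased-novel x-new (square (a ∷ b ∷ c ∷ d ∷ t) q _ refl) =
  lively x-new , potential-square a b c d t q

-- Half-lengths 2 and 3 would repeat the top symbol of `r` within three places. Half-length 1 erases
-- only the new symbol and returns `r`.
erased-lively : ∀ {x r r'} → Lively r → Erased (x ∷ r) r' → potential r' ≤ℚ κ *ℚ potential r
erased-lively {x} {r} _ kept = potential-∷ x r
erased-lively _ (square [] q s≢[] eq) = contradiction refl s≢[]
erased-lively {r = r} _ (square (a ∷ []) q _ refl) = respˡ-≤ (ℚₚ.*-identityˡ (potential r))
  (ℚₚ.*-monoʳ-≤-nonNeg (potential r) {{nonNegative (potential-nonNeg r)}} (from-yes (1ℚ ℚ.≤? κ)))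
erased-lively (lively (_ ∷ y≢ ∷ _)) (square (a ∷ b ∷ []) q _ refl) = contradiction refl y≢
erased-lively (lively (_ ∷ _ ∷ y≢ ∷ _)) (square (a ∷ b ∷ c ∷ []) q _ refl) = contradiction refl y≢
erased-lively {x} {r} _ (square (a ∷ b ∷ c ∷ d ∷ t) q _ refl) =
  ℚₚ.≤-trans (potential-square a b c d t q) (potential-∷ x r)

strategy : Strategy
strategy ms = proj₁ (good-candidate (reverse (current ms)))

mutual
  -- The parity test local to history is not exported by Defs; unification with an
  -- unfolding of history recovers it.
  isEven : Strategy → Strategy → ℕ → ℕ → Bool
  isEven = _

  isEven-solution : ∀ ann ben k →
    history ann ben (suc (suc (suc k))) ≡ history ann ben (suc (suc (suc k)))
  -- The parity test has already reduced its argument `suc (suc k)` to `k`. Abstracting the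
  -- remaining `suc (suc k)` leaves `isEven` applied to distinct variables, so unification has a
  -- unique solution.
  isEven-solution ann ben k with suc (suc k)
  ... | m = refl {x = _ ∷ʳ (if isEven ann ben m k then ann else ben) _}

module _ (ann ben : Strategy) where

  isEven-even : ∀ k t → isEven ann ben k (t ℕ.* 2) ≡ true
  isEven-even k zero = refl
  isEven-even k (suc t) = isEven-even k t

  isEven-odd : ∀ k t → isEven ann ben k (suc (t ℕ.* 2)) ≡ false
  isEven-odd k zero = refl
  isEven-odd k (suc t) = isEven-odd k t

  position-move : ∀ k b → isEven ann ben k k ≡ b →
    position ann ben (suc k) ≡
    move (position ann ben k) ((if b then ann else ben) (history ann ben k))
  position-move k b refl =
    foldl-∷ʳ move [] ((if b then ann else ben) (history ann ben k)) (history ann ben k)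

-- Iterated contraction

Contracts : (ℕ → ℚ) → ℕ → ℚ → Set
Contracts V m c = ∀ t → V (m ℕ.+ t) ≤ℚ c *ℚ V t

module _ {V : ℕ → ℚ} (0≤V : ∀ t → 0ℚ ≤ℚ V t) where

  contracts-+ : ∀ {m n c d} → 0ℚ ≤ℚ c → Contracts V m c → Contracts V n d →
    Contracts V (m ℕ.+ n) (c *ℚ d)
  contracts-+ {m} {n} {c} {d} 0≤c Vm Vn t = begin
    V (m ℕ.+ n ℕ.+ t)   ≡⟨ cong V (ℕₚ.+-assoc m n t) ⟩
    V (m ℕ.+ (n ℕ.+ t)) ≤⟨ Vm (n ℕ.+ t) ⟩
    c *ℚ V (n ℕ.+ t)    ≤⟨ ℚₚ.*-monoˡ-≤-nonNeg c {{nonNegative 0≤c}} (Vn t) ⟩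
    c *ℚ (d *ℚ V t)     ≡⟨ ℚₚ.*-assoc c d (V t) ⟨
    c *ℚ d *ℚ V t       ∎
    where open ℚₚ.≤-Reasoning

  contracts-≤ : ∀ {m c d} → c ≤ℚ d → Contracts V m c → Contracts V m d
  contracts-≤ c≤d Vm t =
    ℚₚ.≤-trans (Vm t) (ℚₚ.*-monoʳ-≤-nonNeg (V t) {{nonNegative (0≤V t)}} c≤d)

  contracts-double : ∀ {m} c d {{_ : NonNegative c}} {c²≤d : True (c *ℚ c ℚ.≤? d)} →
    Contracts V m c → Contracts V (m ℕ.+ m) d
  contracts-double c d {c²≤d = c²≤d} Vm =
    contracts-≤ (toWitness c²≤d) (contracts-+ (ℚₚ.nonNegative⁻¹ c) Vm Vm)

  contracts-^ : ∀ {m c} → 0ℚ ≤ℚ c → Contracts V m c → ∀ n → Contracts V (n ℕ.* m) (c ^ n)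
  contracts-^ 0≤c Vm zero t = ℚₚ.≤-reflexive (sym (ℚₚ.*-identityˡ (V t)))
  contracts-^ 0≤c Vm (suc n) = contracts-+ 0≤c Vm (contracts-^ 0≤c Vm n)

  -- Six squarings, read from the bottom up, each rounded up to a small fraction to keep the
  -- comparisons cheap.
  contracts-64 : Contracts V 1 (+ 24 / 25) → Contracts V 64 (+ 1 / 8)
  contracts-64 =
    contracts-double (+ 1 / 3)   (+ 1 / 8) ∘
    contracts-double (+ 9 / 16)  (+ 1 / 3) ∘
    contracts-double (+ 3 / 4)   (+ 9 / 16) ∘
    contracts-double (+ 6 / 7)   (+ 3 / 4) ∘
    contracts-double (+ 12 / 13) (+ 6 / 7) ∘
    contracts-double (+ 24 / 25) (+ 12 / 13)

-- Decay of the potential and the length bound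

module _ (ben : Strategy) where

  value : ℕ → ℚ
  value k = potential (reverse (position strategy ben k))

  round-contracts : Contracts (λ t → value (t ℕ.* 2)) 1 (+ 24 / 25)
  round-contracts t = begin
    value (suc (suc (t ℕ.* 2)))
      ≡⟨ cong (potential ∘ reverse)
           (position-move strategy ben (suc (t ℕ.* 2)) false
             (isEven-odd strategy ben (suc (t ℕ.* 2)) t)) ⟩
    potential (reverse (move w₁ y))
      ≤⟨ erased-lively (proj₁ ann-move) (move-erased w₁ y) ⟩
    κ *ℚ potential (reverse w₁)
      ≤⟨ ℚₚ.*-monoˡ-≤-nonNeg κ (ℚₚ.≤-trans (proj₂ ann-move) (proj₂ (proj₂ choice))) ⟩
    κ *ℚ (+ 219 / 500 *ℚ value (t ℕ.* 2))
      ≡⟨ ℚₚ.*-assoc κ (+ 219 / 500) (value (t ℕ.* 2)) ⟨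
    κ *ℚ (+ 219 / 500) *ℚ value (t ℕ.* 2)
      ≤⟨ ℚₚ.*-monoʳ-≤-nonNeg (value (t ℕ.* 2)) {{nonNegative (potential-nonNeg (reverse w₀))}}
           -- κ²/5 = 0.95922, just below 0.96.
           (from-yes (κ *ℚ (+ 219 / 500) ℚ.≤? + 24 / 25)) ⟩
    + 24 / 25 *ℚ value (t ℕ.* 2) ∎
    where
    open ℚₚ.≤-Reasoning
    w₀ = position strategy ben (t ℕ.* 2)
    w₁ = position strategy ben (suc (t ℕ.* 2))
    y = ben (history strategy ben (suc (t ℕ.* 2)))
    choice = good-candidate (reverse w₀)

    ann-move : Lively (reverse w₁) × potential (reverse w₁) ≤ℚ potential (proj₁ choice ∷ reverse w₀)
    ann-move = erased-novel (proj₁ (proj₂ choice))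
      (subst (Erased (proj₁ choice ∷ reverse w₀))
        (cong reverse (sym (position-move strategy ben (t ℕ.* 2) true
          (isEven-even strategy ben (t ℕ.* 2) t))))
        (move-erased w₀ (proj₁ choice)))

  value-≤ : ∀ n → value ((n ℕ.* 64) ℕ.* 2) ≤ℚ (+ 1 / 8) ^ n
  value-≤ n = begin
    value ((n ℕ.* 64) ℕ.* 2)
      ≡⟨ cong (λ k → value (k ℕ.* 2)) (ℕₚ.+-identityʳ (n ℕ.* 64)) ⟨
    value ((n ℕ.* 64 ℕ.+ 0) ℕ.* 2)
      ≤⟨ contracts-^ 0≤value (ℚₚ.nonNegative⁻¹ (+ 1 / 8))
           (contracts-64 0≤value round-contracts) n 0 ⟩
    -- The factor `1ℚ` is the potential of the empty starting word.
    (+ 1 / 8) ^ n *ℚ 1ℚ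
      ≡⟨ ℚₚ.*-identityʳ ((+ 1 / 8) ^ n) ⟩
    (+ 1 / 8) ^ n ∎
    where
    open ℚₚ.≤-Reasoning
    0≤value : ∀ t → 0ℚ ≤ℚ value (t ℕ.* 2)
    0≤value t = potential-nonNeg (reverse (position strategy ben (t ℕ.* 2)))

⅛^-cancel-≤ : ∀ m n → (+ 1 / 8) ^ m ≤ℚ (+ 1 / 8) ^ n → n ≤ m
⅛^-cancel-≤ m zero _ = z≤n
⅛^-cancel-≤ zero (suc n) 1≤ = contradiction (ℚₚ.≤-trans 1≤ (≤⅛ n)) (from-no (1ℚ ℚ.≤? + 1 / 8))
  where
  ≤⅛ : ∀ n → (+ 1 / 8) ^ suc n ≤ℚ + 1 / 8
  ≤⅛ zero = ℚₚ.≤-refl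
  ≤⅛ (suc n) = ℚₚ.≤-trans (ℚₚ.*-monoˡ-≤-nonNeg (+ 1 / 8) (≤⅛ n))
    (from-yes (+ 1 / 8 *ℚ (+ 1 / 8) ℚ.≤? + 1 / 8))
⅛^-cancel-≤ (suc m) (suc n) le = s≤s (⅛^-cancel-≤ m n (ℚₚ.*-cancelˡ-≤-pos (+ 1 / 8) le))

theorem1 : (n : ℕ) → n > 0 →
    Σ Strategy λ ann → (ben : Strategy) →
    ∃ λ k → n ≤ length (position ann ben k)
theorem1 n _ = strategy , λ ben →
  -- Each of `n` blocks of 64 rounds gains a factor 1/8, and a round is two moves.
  let k = (n ℕ.* 64) ℕ.* 2
      w = position strategy ben k
      r = reverse w
      ⅛^∣r∣≤ = ℚₚ.≤-trans
        (x≤x+y ((+ 1 / 8) ^ length r) (∑-nonNeg (cost-nonNeg (pending-nonNeg r)))) (value-≤ ben n)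
  in k , subst (n ≤_) (length-reverse w) (⅛^-cancel-≤ (length r) n ⅛^∣r∣≤)
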